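{- For $N\in\mathbb N$, let $\mathrm{Dec}(N)$ be the set of subsets $A\subset[0,N]$ for which there exist $B,C\subset[0,N]$ with $A=B+C$ and $\min(|B|,|C|)\ge 2$. If $A$ is a subset of $[0,N]$ chosen uniformly at random (equivalently, each element of $[0,N]$ is included independently with probability $1/2$), then \[\mathbb P\big(A\in\mathrm{Dec}(N)\big)=\exp(-\Omega(N)),\] that is, there are constants $c>0$ and $K>0$ such that $|\mathrm{Dec}(N)|\le K\,2^{N+1}e^{ -cN}$ for all $N\in\mathbb N$.
   Context: For real numbers $a\le b$, $[a,b]=\{x\in\mathbb Z\colon a\le x\le b\}$. For sets $B,C\subset\mathbb Z$, $B+C=\{b+c\colon b\in B,c\in C\}$. -}

module Defs where

open import Data.Nat using (ℕ; suc; _+_; _≤_)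
open import Data.Fin using (Fin; toℕ)
open import Data.Fin.Subset using (Subset; _∈_; ∣_∣)
open import Data.Product using (Σ; _×_; ∃-syntax)
open import Relation.Binary.PropositionalEquality using (_≡_)

-- The integer interval [0,N] is represented by Fin (suc N) (via toℕ);
-- a subset of [0,N] is a Data.Fin.Subset (suc N).

IsSumset : ∀ {N} → Subset (suc N) → Subset (suc N) → Subset (suc N) → Set
IsSumset {N} A B C =
  (∀ (b c : Fin (suc N)) → b ∈ B → c ∈ C →
     ∃[ a ] (a ∈ A × toℕ a ≡ toℕ b + toℕ c))
  × (∀ (a : Fin (suc N)) → a ∈ A →
     ∃[ b ] ∃[ c ] (b ∈ B × c ∈ C × toℕ a ≡ toℕ b + toℕ c))

InDec : (N : ℕ) → Subset (suc N) → Set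
InDec N A = ∃[ B ] ∃[ C ] (IsSumset A B C × 2 ≤ ∣ B ∣ × 2 ≤ ∣ C ∣)

{-# OPTIONS --safe #-}
module Submission where

-- Write A = B + C, let m = max B, so that C ⊆ [0, N − m], and let k = ⌊N / 122⌋.
--
-- If m ≥ k and N − m ≥ k, either A contains the whole of [k, N − k], or it misses some x there.
-- In the latter case k disjoint pairs (b, x − b) satisfy ¬ (b ∈ B ∧ x − b ∈ C), which leaves a
-- proportion (3/4)^k of the 2^(N+2) pairs (B , C).
--
-- Otherwise one summand, say C, lies in [0, k) and contains c < c + d.  Take P = 60 k disjoint
-- pairs (i, i + d) of coordinates.  Since A ⊇ (B + c) ∪ (B + c + d), the number of j in these pairs
-- with j + c ∈ A is at least Σ ([i ∈ B] + [i ∈ B ∨ i + d ∈ B]), whose mean is 5/4 per pair.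
-- So either A has at least 1.1 elements per translated pair, or that sum is at most 1.1 P; both are
-- large deviations, bounded by exponential weights.  The 2^k choices of C and polynomially many
-- choices of the remaining parameters are absorbed.
--
-- B and C are coded by their concatenation, so every case is an estimate for a product over
-- disjoint pairs of coordinates of a uniformly random bit vector.

open import Defs
open import Data.Bool using (Bool; true; false; if_then_else_; _∧_; _∨_)
import Data.Bool.Properties as Bool
open import Data.Unit using (tt)
open import Data.Empty using (⊥)
open import Data.Fin.Base using (Fin; zero; suc; toℕ)
open import Data.Fin.Properties using (toℕ-fromℕ<)
open import Data.Fin.Subset using (Subset; ∣_∣)
open import Data.List using (List; []; _∷_; length)
open import Data.List.Relation.Unary.All as All using (All; []; _∷_)
open import Data.List.Relation.Binary.Sublist.Propositional using (_⊆_; []; _∷_; _∷ʳ_)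
open import Data.List.Relation.Binary.Sublist.Propositional.Properties using (All-resp-⊆)
open import Data.List.Relation.Unary.AllPairs using ([]; _∷_)
open import Data.List.Relation.Unary.Unique.Propositional using (Unique)
open import Data.Nat using (ℕ; zero; suc; _+_; _*_; _^_; _∸_; _≤_; _<_; z≤n; s≤s; NonZero; >-nonZero⁻¹)
open import Data.Nat.Divisibility using (n∣m*n)
open import Data.Nat.DivMod using (_/_; _%_; m/n*n≤m; m*n/n≡m; /-monoˡ-≤; +-distrib-/-∣ʳ; m≡m%n+[m/n]*n; m%n<n)
open import Data.Nat.Properties
open import Data.Nat.Tactic.RingSolver using (solve-∀)
open import Data.Product using (_×_; _,_; proj₂; ∃-syntax)
open import Data.Sum using (_⊎_; inj₁; inj₂)
open import Data.Vec using (Vec; []; _∷_; _++_; _[_]=_; here; there)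
open import Data.Vec.Properties using (++-injective; ∷-injectiveʳ; ≡-dec)
open import Function using (_∘_; case_of_)
open import Relation.Binary.Definitions using (tri<; tri≈; tri>)
open import Relation.Binary.PropositionalEquality
open import Relation.Nullary using (Dec; _×-dec_; does; yes; no; contradiction; ¬_)

private variable
  m n l : ℕ

-- Bit vectors as finite sets of natural numbers.

-- A vector is read as a subset of ℕ: beyond its length, at is false and set does nothing.
at : Vec Bool n → ℕ → Bool
at []      _       = false
at (x ∷ v) zero    = x
at (x ∷ v) (suc i) = at v i

set : Vec Bool n → ℕ → Bool → Vec Bool n
set []      _       _ = []
set (_ ∷ v) zero    b = b ∷ v
set (x ∷ v) (suc i) b = x ∷ set v i b

infix 4 _∈ᵛ_
_∈ᵛ_ : ℕ → Vec Bool n → Set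
i ∈ᵛ v = at v i ≡ true

at-set : ∀ (v : Vec Bool n) {i b} → i < n → at (set v i b) i ≡ b
at-set (_ ∷ v) {zero}  _         = refl
at-set (_ ∷ v) {suc i} (s≤s i<n) = at-set v i<n

at-set-≢ : ∀ (v : Vec Bool n) {i j b} → i ≢ j → at (set v i b) j ≡ at v j
at-set-≢ []      _                     = refl
at-set-≢ (_ ∷ v) {zero}  {zero}  i≢j   = contradiction refl i≢j
at-set-≢ (_ ∷ v) {zero}  {suc j} i≢j   = refl
at-set-≢ (_ ∷ v) {suc i} {zero}  i≢j   = refl
at-set-≢ (_ ∷ v) {suc i} {suc j} i≢j   = at-set-≢ v (i≢j ∘ cong suc)

∈ᵛ⇒< : ∀ (v : Vec Bool n) {i} → i ∈ᵛ v → i < n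
∈ᵛ⇒< (_ ∷ v) {zero}  _   = s≤s z≤n
∈ᵛ⇒< (_ ∷ v) {suc i} i∈v = s≤s (∈ᵛ⇒< v i∈v)

at-++ˡ : ∀ (u : Vec Bool m) (v : Vec Bool n) {i} → i < m → at (u ++ v) i ≡ at u i
at-++ˡ (_ ∷ u) v {zero}  _         = refl
at-++ˡ (_ ∷ u) v {suc i} (s≤s i<m) = at-++ˡ u v i<m

at-++ʳ : ∀ (u : Vec Bool m) (v : Vec Bool n) {i} → at (u ++ v) (m + i) ≡ at v i
at-++ʳ []      v = refl
at-++ʳ (_ ∷ u) v = at-++ʳ u v

restrict : ∀ n → (ℕ → Bool) → Vec Bool n
restrict zero    f = []
restrict (suc n) f = f 0 ∷ restrict n (f ∘ suc)

at-restrict : ∀ {f i} → i < n → at (restrict n f) i ≡ f i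
at-restrict {suc n} {i = zero}  _         = refl
at-restrict {suc n} {i = suc i} (s≤s i<n) = at-restrict {n} i<n

at-ext : ∀ {u v : Vec Bool n} → (∀ i → at u i ≡ at v i) → u ≡ v
at-ext {u = []}    {[]}    _  = refl
at-ext {u = x ∷ u} {y ∷ v} eq = cong₂ _∷_ (eq 0) (at-ext (eq ∘ suc))

∈ᵛ-ext : ∀ {u v : Vec Bool n} → (∀ i → i ∈ᵛ u → i ∈ᵛ v) → (∀ i → i ∈ᵛ v → i ∈ᵛ u) → u ≡ v
∈ᵛ-ext {u = u} {v} u⊆v v⊆u = at-ext λ i → eq (u⊆v i) (v⊆u i)
  where
  eq : ∀ {a b} → (a ≡ true → b ≡ true) → (b ≡ true → a ≡ true) → a ≡ b
  eq {false} {false} _ _ = refl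
  eq {false} {true}  _ g = g refl
  eq {true}  {_}     f _ = sym (f refl)

maximum : ∀ (v : Vec Bool n) → (∀ i → ¬ i ∈ᵛ v) ⊎ (∃[ m ] (m ∈ᵛ v × (∀ i → i ∈ᵛ v → i ≤ m)))
maximum [] = inj₁ λ _ ()
maximum (x ∷ v) with maximum v
... | inj₂ (m , m∈v , max) = inj₂ (suc m , m∈v , λ { zero _ → z≤n ; (suc i) i∈v → s≤s (max i i∈v) })
maximum (true  ∷ v) | inj₁ ∉v = inj₂ (0 , refl , λ { zero _ → z≤n ; (suc i) i∈v → contradiction i∈v (∉v i) })
maximum (false ∷ v) | inj₁ ∉v = inj₁ λ { zero () ; (suc i) → ∉v i }

1≤∣∣⇒∃ : ∀ (v : Subset n) → 1 ≤ ∣ v ∣ → ∃[ i ] i ∈ᵛ v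
1≤∣∣⇒∃ (true  ∷ v) _ = 0 , refl
1≤∣∣⇒∃ (false ∷ v) p = let i , i∈v = 1≤∣∣⇒∃ v p in suc i , i∈v

2≤∣∣⇒∃₂ : ∀ (v : Subset n) → 2 ≤ ∣ v ∣ → ∃[ i ] ∃[ j ] (i < j × i ∈ᵛ v × j ∈ᵛ v)
2≤∣∣⇒∃₂ (true  ∷ v) (s≤s p) = let j , j∈v = 1≤∣∣⇒∃ v p in 0 , suc j , s≤s z≤n , refl , j∈v
2≤∣∣⇒∃₂ (false ∷ v) p       = let i , j , i<j , i∈v , j∈v = 2≤∣∣⇒∃₂ v p in suc i , suc j , s≤s i<j , i∈v , j∈v

[]=⇒∈ᵛ : ∀ {v : Subset n} {i} → v [ i ]= true → toℕ i ∈ᵛ v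
[]=⇒∈ᵛ here       = refl
[]=⇒∈ᵛ (there eq) = []=⇒∈ᵛ eq

∈ᵛ⇒[]= : ∀ {v : Subset n} (i : Fin n) → toℕ i ∈ᵛ v → v [ i ]= true
∈ᵛ⇒[]= {v = _ ∷ v} zero    refl = here
∈ᵛ⇒[]= {v = _ ∷ v} (suc i) i∈v  = there (∈ᵛ⇒[]= i i∈v)

-- Sumsets of bit vectors.

-- The lengths are independent, so that summands can be shortened while `A` keeps its length.
record Sumset (A : Vec Bool l) (B : Vec Bool m) (C : Vec Bool n) : Set where
  field
    +-∈    : ∀ {b c} → b ∈ᵛ B → c ∈ᵛ C → b + c ∈ᵛ A
    ∈-∃₂   : ∀ {a} → a ∈ᵛ A → ∃[ b ] ∃[ c ] (b ∈ᵛ B × c ∈ᵛ C × a ≡ b + c)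
open Sumset

Sumset-comm : ∀ {A : Vec Bool l} {B : Vec Bool m} {C : Vec Bool n} → Sumset A B C → Sumset A C B
Sumset-comm {A = A} S .+-∈ {b} {c} b∈C c∈B = subst (_∈ᵛ A) (+-comm c b) (S .+-∈ c∈B b∈C)
Sumset-comm S .∈-∃₂ a∈A = let b , c , b∈B , c∈C , eq = S .∈-∃₂ a∈A in c , b , c∈C , b∈B , trans eq (+-comm b c)

Sumset-functional : ∀ {A A′ : Vec Bool l} {B : Vec Bool m} {C : Vec Bool n} → Sumset A B C → Sumset A′ B C → A ≡ A′
Sumset-functional S S′ = ∈ᵛ-ext (λ _ → sub S S′) (λ _ → sub S′ S)
  where
  sub : ∀ {A A′ : Vec Bool l} {B : Vec Bool m} {C : Vec Bool n} → Sumset A B C → Sumset A′ B C → ∀ {i} → i ∈ᵛ A → i ∈ᵛ A′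
  sub {A′ = A′} S S′ i∈A = let b , c , b∈B , c∈C , eq = S .∈-∃₂ i∈A in subst (_∈ᵛ A′) (sym eq) (S′ .+-∈ b∈B c∈C)

-- Cutting at upper bounds for the summands loses no element and leaves only 2^(s + r) pairs of
-- vectors to count.
Sumset-restrict : ∀ {A : Vec Bool l} {B : Vec Bool m} {C : Vec Bool n} s r →
                  (∀ {b} → b ∈ᵛ B → b < s) → (∀ {c} → c ∈ᵛ C → c < r) →
                  Sumset A B C → Sumset A (restrict s (at B)) (restrict r (at C))
Sumset-restrict {A = A} {B} {C} s r B<s C<r S = record
  { +-∈  = λ b∈ c∈ → S .+-∈ (back s b∈) (back r c∈)
  ; ∈-∃₂ = λ a∈A → let b , c , b∈B , c∈C , eq = S .∈-∃₂ a∈A in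
             b , c , trans (at-restrict (B<s b∈B)) b∈B , trans (at-restrict (C<r c∈C)) c∈C , eq }
  where
  back : ∀ s {f i} → i ∈ᵛ restrict s f → f i ≡ true
  back s {f} i∈ = trans (sym (at-restrict (∈ᵛ⇒< (restrict s f) i∈))) i∈

IsSumset⇒Sumset : ∀ {N} {A B C : Subset (suc N)} → IsSumset A B C → Sumset A B C
IsSumset⇒Sumset {N} {A} {B} {C} (sum⊆A , A⊆sum) = record { +-∈ = add ; ∈-∃₂ = split }
  where
  add : ∀ {b c} → b ∈ᵛ B → c ∈ᵛ C → b + c ∈ᵛ A
  add {b} {c} b∈B c∈C
    with sum⊆A _ _ (∈ᵛ⇒[]= _ (subst (_∈ᵛ B) (sym (toℕ-fromℕ< (∈ᵛ⇒< B b∈B))) b∈B))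
                   (∈ᵛ⇒[]= _ (subst (_∈ᵛ C) (sym (toℕ-fromℕ< (∈ᵛ⇒< C c∈C))) c∈C))
  ... | a , a∈A , eq = subst (_∈ᵛ A) (trans eq (cong₂ _+_ (toℕ-fromℕ< (∈ᵛ⇒< B b∈B)) (toℕ-fromℕ< (∈ᵛ⇒< C c∈C)))) ([]=⇒∈ᵛ a∈A)
  split : ∀ {a} → a ∈ᵛ A → ∃[ b ] ∃[ c ] (b ∈ᵛ B × c ∈ᵛ C × a ≡ b + c)
  split {a} a∈A with A⊆sum _ (∈ᵛ⇒[]= _ (subst (_∈ᵛ A) (sym (toℕ-fromℕ< (∈ᵛ⇒< A a∈A))) a∈A))
  ... | b , c , b∈B , c∈C , eq = toℕ b , toℕ c , []=⇒∈ᵛ b∈B , []=⇒∈ᵛ c∈C , trans (sym (toℕ-fromℕ< _)) eq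

-- Sums over all bit vectors.

∑ : ∀ n → (Vec Bool n → ℕ) → ℕ
∑ zero    g = g []
∑ (suc n) g = ∑ n (g ∘ (false ∷_)) + ∑ n (g ∘ (true ∷_))

∑-cong : ∀ n {g h : Vec Bool n → ℕ} → (∀ v → g v ≡ h v) → ∑ n g ≡ ∑ n h
∑-cong zero    eq = eq []
∑-cong (suc n) eq = cong₂ _+_ (∑-cong n (eq ∘ _)) (∑-cong n (eq ∘ _))

∑-mono : ∀ n {g h : Vec Bool n → ℕ} → (∀ v → g v ≤ h v) → ∑ n g ≤ ∑ n h
∑-mono zero    le = le []
∑-mono (suc n) le = +-mono-≤ (∑-mono n (le ∘ _)) (∑-mono n (le ∘ _))

∑-+ : ∀ n (g h : Vec Bool n → ℕ) → ∑ n (λ v → g v + h v) ≡ ∑ n g + ∑ n h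
∑-+ zero    g h = refl
∑-+ (suc n) g h = trans (cong₂ _+_ (∑-+ n _ _) (∑-+ n _ _)) (lemma (∑ n (g ∘ (false ∷_))) _ _ _)
  where
  lemma : ∀ a b c d → (a + b) + (c + d) ≡ (a + c) + (b + d)
  lemma = solve-∀

∑-*ˡ : ∀ n c (g : Vec Bool n → ℕ) → ∑ n (λ v → c * g v) ≡ c * ∑ n g
∑-*ˡ zero    c g = refl
∑-*ˡ (suc n) c g = trans (cong₂ _+_ (∑-*ˡ n c _) (∑-*ˡ n c _)) (sym (*-distribˡ-+ c _ _))

∑-1 : ∀ n → ∑ n (λ _ → 1) ≡ 2 ^ n
∑-1 zero    = refl
∑-1 (suc n) = cong₂ _+_ (∑-1 n) (trans (∑-1 n) (sym (+-identityʳ _)))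

-- Overwriting one coordinate by both values visits every vector exactly twice. This integrates out
-- a single coordinate.
∑-resample : ∀ n i (g : Vec Bool n → ℕ) → ∑ n (λ v → g (set v i false) + g (set v i true)) ≡ 2 * ∑ n g
∑-resample zero    i       g = cong (g [] +_) (sym (+-identityʳ _))
∑-resample (suc n) zero    g = trans (cong₂ _+_ eq eq) (cong (∑ (suc n) g +_) (sym (+-identityʳ _)))
  where eq = ∑-+ n (g ∘ (false ∷_)) (g ∘ (true ∷_))
∑-resample (suc n) (suc i) g =
  trans (cong₂ _+_ (∑-resample n i _) (∑-resample n i _)) (sym (*-distribˡ-+ 2 (∑ n (g ∘ (false ∷_))) _))

-- Slack at a single vector survives summation; in `Count-weight` it pays for one list element.
∑-point : ∀ {n} (v : Vec Bool n) {g h : Vec Bool n → ℕ} {c} →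
          g v + c ≤ h v → (∀ u → u ≢ v → g u ≤ h u) → ∑ n g + c ≤ ∑ n h
∑-point []          gv≤ _   = gv≤
∑-point {suc n} (false ∷ v) {g} {h} {c} gv≤ le = begin
  x + y + c    ≡⟨ lemma x y c ⟩
  (x + c) + y  ≤⟨ +-mono-≤ (∑-point v gv≤ λ u u≢v → le _ (u≢v ∘ ∷-injectiveʳ)) (∑-mono n λ u → le _ λ ()) ⟩
  ∑ (suc n) h  ∎
  where
  open ≤-Reasoning
  x = ∑ n (g ∘ (false ∷_))
  y = ∑ n (g ∘ (true ∷_))
  lemma : ∀ a b c → a + b + c ≡ (a + c) + b
  lemma = solve-∀
∑-point {suc n} (true ∷ v) {g} {h} {c} gv≤ le = begin
  x + y + c    ≡⟨ +-assoc x y c ⟩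
  x + (y + c)  ≤⟨ +-mono-≤ (∑-mono n λ u → le _ λ ()) (∑-point v gv≤ λ u u≢v → le _ (u≢v ∘ ∷-injectiveʳ)) ⟩
  ∑ (suc n) h  ∎
  where
  open ≤-Reasoning
  x = ∑ n (g ∘ (false ∷_))
  y = ∑ n (g ∘ (true ∷_))

-- Counting with duplicate-free lists.

-- `P` may be undecidable, so its cardinality is bounded through duplicate-free lists; `u` is a
-- denominator, which keeps all estimates in ℕ.
Count : (Vec Bool n → Set) → ℕ → ℕ → Set
Count {n} P u w = ∀ (L : List (Vec Bool n)) → Unique L → All P L → length L * u ≤ w

Count-⊆ : ∀ {P Q : Vec Bool n → Set} {u w} → (∀ {v} → P v → Q v) → Count Q u w → Count P u w
Count-⊆ P⊆Q count L uniq pL = count L uniq (All.map P⊆Q pL)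

-- `G` does not depend on the vector: a nonempty list supplies it, and an empty list satisfies any
-- bound.
Count-assume : ∀ {P : Vec Bool n → Set} {G : Set} {u w} → (G → Count P u w) → Count (λ v → G × P v) u w
Count-assume count []      _    _               = z≤n
Count-assume count (v ∷ L) uniq ((g , pv) ∷ ps) = count g (v ∷ L) uniq (pv ∷ All.map proj₂ ps)

-- Markov's inequality. The induction sets the weight to 0 at the head of the list, so that the tail
-- is paid for by the other vectors.
Count-weight : ∀ (w : Vec Bool n → ℕ) {u} → Count (λ v → u ≤ w v) u (∑ n w)
Count-weight w [] _ _ = z≤n
Count-weight {n} w {u} (v ∷ L) (v∉L ∷ uniq) (u≤wv ∷ u≤w) = begin
  u + length L * u  ≡⟨ +-comm u _ ⟩
  length L * u + u  ≤⟨ +-monoˡ-≤ u (Count-weight w′ L uniq (All.zipWith (λ (v≢x , u≤wx) → ≤-trans u≤wx (≤-reflexive (sym (off-v v≢x)))) (v∉L , u≤w))) ⟩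
  ∑ n w′ + u        ≤⟨ ∑-point v at-v (λ x x≢v → ≤-reflexive (off-v (x≢v ∘ sym))) ⟩
  ∑ n w             ∎
  where
  open ≤-Reasoning
  w′ : Vec Bool n → ℕ
  w′ x = if does (≡-dec Bool._≟_ v x) then 0 else w x
  off-v : ∀ {x} → v ≢ x → w′ x ≡ w x
  off-v {x} v≢x with ≡-dec Bool._≟_ v x
  ... | yes v≡x = contradiction v≡x v≢x
  ... | no  _   = refl
  at-v : w′ v + u ≤ w v
  at-v with ≡-dec Bool._≟_ v v
  ... | yes _   = u≤wv
  ... | no  v≢v = contradiction refl v≢v

Unique-resp-⊆ : ∀ {L M : List (Vec Bool n)} → L ⊆ M → Unique M → Unique L
Unique-resp-⊆ []         []         = []
Unique-resp-⊆ (_ ∷ʳ τ)   (_ ∷ uniq) = Unique-resp-⊆ τ uniq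
Unique-resp-⊆ (refl ∷ τ) (x ∷ uniq) = All-resp-⊆ τ x ∷ Unique-resp-⊆ τ uniq

-- Union bound: the list splits into two sublists, and these inherit uniqueness.
Count-⊎ : ∀ {P Q : Vec Bool n → Set} {u w w′} → Count P u w → Count Q u w′ → Count (λ v → P v ⊎ Q v) u (w + w′)
Count-⊎ {n} {P} {Q} {u} {w} {w′} countP countQ L uniq pq =
  let M , M′ , τ , τ′ , eq , pM , qM′ = partition L pq in begin
  length L * u                    ≡⟨ cong (_* u) eq ⟩
  (length M + length M′) * u      ≡⟨ *-distribʳ-+ u (length M) _ ⟩
  length M * u + length M′ * u    ≤⟨ +-mono-≤ (countP M (Unique-resp-⊆ τ uniq) pM) (countQ M′ (Unique-resp-⊆ τ′ uniq) qM′) ⟩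
  w + w′                          ∎
  where
  open ≤-Reasoning
  partition : ∀ L → All (λ v → P v ⊎ Q v) L →
              ∃[ M ] ∃[ M′ ] (M ⊆ L × M′ ⊆ L × length L ≡ length M + length M′ × All P M × All Q M′)
  partition []      []             = [] , [] , [] , [] , refl , [] , []
  partition (x ∷ L) (inj₁ p ∷ pqs) =
    let M , M′ , τ , τ′ , eq , pM , qM′ = partition L pqs in
    x ∷ M , M′ , refl ∷ τ , x ∷ʳ τ′ , cong suc eq , p ∷ pM , qM′
  partition (x ∷ L) (inj₂ q ∷ pqs) =
    let M , M′ , τ , τ′ , eq , pM , qM′ = partition L pqs in
    M , x ∷ M′ , x ∷ʳ τ , refl ∷ τ′ , trans (cong suc eq) (sym (+-suc (length M) _)) , pM , q ∷ qM′

Count-∃< : ∀ {P : ℕ → Vec Bool n → Set} {u w} b → (∀ i → i < b → Count (P i) u w) →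
           Count (λ v → ∃[ i ] (i < b × P i v)) u (b * w)
Count-∃< zero    count []      _ _                   = z≤n
Count-∃< zero    count (_ ∷ _) _ ((_ , () , _) ∷ _)
Count-∃< {P = P} (suc b) count =
  Count-⊆ split (Count-⊎ (count b ≤-refl) (Count-∃< b λ i i<b → count i (m<n⇒m<1+n i<b)))
  where
  split : ∀ {v} → ∃[ i ] (i < suc b × P i v) → P b v ⊎ (∃[ i ] (i < b × P i v))
  split (i , s≤s i≤b , p) with m≤n⇒m<n∨m≡n i≤b
  ... | inj₁ i<b  = inj₂ (i , i<b , p)
  ... | inj₂ refl = inj₁ p

-- One code is chosen for each listed object; as a code determines its object, the chosen codes are
-- distinct.
Count-encode : ∀ {R : Vec Bool m → Vec Bool n → Set} {Q : Vec Bool m → Set} {u w} →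
               (∀ {x y y′} → R x y → R x y′ → y ≡ y′) → Count Q u w → Count (λ y → ∃[ x ] (R x y × Q x)) u w
Count-encode {R = R} {Q} {u} {w} functional count L uniq codes =
  let M , eq , _ , uniqM , qM = encode L uniq codes in subst (λ l → l * u ≤ w) eq (count M uniqM qM)
  where
  encode : ∀ L → Unique L → All (λ y → ∃[ x ] (R x y × Q x)) L →
           -- The third component strengthens the induction: an object outside `L` has no code in
           -- `M`.
           ∃[ M ] (length M ≡ length L × (∀ {z} → All (z ≢_) L → ∀ {x} → R x z → All (x ≢_) M) × Unique M × All Q M)
  encode []      []           []                  = [] , refl , (λ _ _ → []) , [] , []
  encode (y ∷ L) (y∉L ∷ uniq) ((x , r , q) ∷ xs) =
    let M , eq , fresh , uniqM , qM = encode L uniq xs in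
    x ∷ M , cong suc eq ,
    (λ { (z≢y ∷ z∉L) r′ → (λ { refl → z≢y (functional r′ r) }) ∷ fresh z∉L r′ }) ,
    fresh y∉L r ∷ uniqM , q ∷ qM

-- Products over disjoint pairs of coordinates.

-- The 2k coordinates are distinct, so the k pairs of bits are independent under the uniform
-- distribution.
record Disjoint (n k : ℕ) (I J : ℕ → ℕ) : Set where
  field
    I<    : ∀ {j} → j < k → I j < n
    J<    : ∀ {j} → j < k → J j < n
    I-inj : ∀ {i j} → i < k → j < k → I i ≡ I j → i ≡ j
    J-inj : ∀ {i j} → i < k → j < k → J i ≡ J j → i ≡ j
    I≢J   : ∀ {i j} → i < k → j < k → I i ≢ J j

Disjoint-pred : ∀ {k I J} → Disjoint n (suc k) I J → Disjoint n k I J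
Disjoint-pred d = record
  { I<    = λ j<k → I< (m<n⇒m<1+n j<k)
  ; J<    = λ j<k → J< (m<n⇒m<1+n j<k)
  ; I-inj = λ i<k j<k → I-inj (m<n⇒m<1+n i<k) (m<n⇒m<1+n j<k)
  ; J-inj = λ i<k j<k → J-inj (m<n⇒m<1+n i<k) (m<n⇒m<1+n j<k)
  ; I≢J   = λ i<k j<k → I≢J (m<n⇒m<1+n i<k) (m<n⇒m<1+n j<k) }
  where open Disjoint d

weight : (Bool → Bool → ℕ) → (I J : ℕ → ℕ) → ℕ → Vec Bool n → ℕ
weight f I J zero    v = 1
weight f I J (suc k) v = f (at v (I k)) (at v (J k)) * weight f I J k v

-- Four times the mean of `f` on two independent uniform bits.
total : (Bool → Bool → ℕ) → ℕ
total f = (f false false + f true false) + (f false true + f true true)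

weight-set : ∀ f {I J} k (v : Vec Bool n) {i b} → (∀ {j} → j < k → i ≢ I j) → (∀ {j} → j < k → i ≢ J j) →
             weight f I J k (set v i b) ≡ weight f I J k v
weight-set f zero    v i≢I i≢J = refl
weight-set f (suc k) v i≢I i≢J = cong₂ _*_ (cong₂ f (at-set-≢ v (i≢I ≤-refl)) (at-set-≢ v (i≢J ≤-refl)))
  (weight-set f k v (i≢I ∘ m<n⇒m<1+n) (i≢J ∘ m<n⇒m<1+n))

-- The mean of a product of independent factors is the product of the means, here cleared of the
-- denominators 4^k. The last pair is resampled first.
∑-weight : ∀ f {I J} k → Disjoint n k I J → 4 ^ k * ∑ n (weight f I J k) ≡ total f ^ k * 2 ^ n
∑-weight {n} f zero    d = cong (1 *_) (∑-1 n)
∑-weight {n} f {I} {J} (suc k) d = begin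
  4 * 4 ^ k * ∑ n W′                   ≡⟨ assoc (4 ^ k) (∑ n W′) ⟩
  4 ^ k * (2 * (2 * ∑ n W′))           ≡⟨ cong (λ x → 4 ^ k * (2 * x)) (∑-resample n (I k) W′) ⟨
  4 ^ k * (2 * ∑ n W₁)                 ≡⟨ cong (4 ^ k *_) (∑-resample n (J k) W₁) ⟨
  4 ^ k * ∑ n (λ v → W₁ (set v (J k) false) + W₁ (set v (J k) true))
                                       ≡⟨ cong (4 ^ k *_) (∑-cong n λ v → cong₂ _+_ (pair v false) (pair v true)) ⟩
  4 ^ k * ∑ n (λ v → (f false false + f true false) * W v + (f false true + f true true) * W v)
                                       ≡⟨ cong (4 ^ k *_) (∑-cong n λ v → *-distribʳ-+ (W v) (f false false + f true false) _) ⟨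
  4 ^ k * ∑ n (λ v → total f * W v)    ≡⟨ cong (4 ^ k *_) (∑-*ˡ n (total f) W) ⟩
  4 ^ k * (total f * ∑ n W)            ≡⟨ swap (4 ^ k) (total f) (∑ n W) ⟩
  total f * (4 ^ k * ∑ n W)            ≡⟨ cong (total f *_) (∑-weight f k (Disjoint-pred d)) ⟩
  total f * (total f ^ k * 2 ^ n)      ≡⟨ *-assoc (total f) _ _ ⟨
  total f * total f ^ k * 2 ^ n        ∎
  where
  open ≡-Reasoning
  open Disjoint d
  W W′ W₁ : Vec Bool n → ℕ
  W  = weight f I J k
  W′ = weight f I J (suc k)
  W₁ v = W′ (set v (I k) false) + W′ (set v (I k) true)
  assoc : ∀ a b → 4 * a * b ≡ a * (2 * (2 * b))
  assoc = solve-∀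
  swap : ∀ a b c → a * (b * c) ≡ b * (a * c)
  swap = solve-∀
  -- The last pair now has prescribed bits, and by disjointness the other factors do not see the
  -- change.
  single : ∀ v a b → W′ (set (set v (J k) b) (I k) a) ≡ f a b * W v
  single v a b = cong₂ _*_
    (cong₂ f (at-set (set v (J k) b) (I< ≤-refl))
             (trans (at-set-≢ (set v (J k) b) (I≢J ≤-refl ≤-refl)) (at-set v (J< ≤-refl))))
    (trans (weight-set f k _ (λ j<k eq → <⇒≢ j<k (sym (I-inj ≤-refl (m<n⇒m<1+n j<k) eq))) (λ j<k → I≢J ≤-refl (m<n⇒m<1+n j<k)))
           (weight-set f k v (λ j<k eq → I≢J (m<n⇒m<1+n j<k) ≤-refl (sym eq)) (λ j<k eq → <⇒≢ j<k (sym (J-inj ≤-refl (m<n⇒m<1+n j<k) eq)))))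
  pair : ∀ v b → W₁ (set v (J k) b) ≡ (f false b + f true b) * W v
  pair v b = trans (cong₂ _+_ (single v false b) (single v true b)) (sym (*-distribʳ-+ (W v) (f false b) _))

-- Markov's inequality for a product weight; `z` makes room for the factor y^t of an exponential
-- tail bound.
Count-weight-pairs : ∀ {k} f {I J} → Disjoint n k I J → ∀ z {u} →
                     Count (λ v → u ≤ z * weight f I J k v) (u * 4 ^ k) (z * (total f ^ k * 2 ^ n))
Count-weight-pairs {n = n} {k = k} f {I} {J} d z {u} L uniq u≤ = begin
  length L * (u * 4 ^ k)      ≡⟨ *-assoc (length L) u _ ⟨
  length L * u * 4 ^ k        ≤⟨ *-monoˡ-≤ (4 ^ k) (Count-weight (λ (v : Vec Bool n) → z * weight f I J k v) L uniq u≤) ⟩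
  ∑ n (λ (v : Vec Bool n) → z * weight f I J k v) * 4 ^ k  ≡⟨ cong (_* 4 ^ k) (∑-*ˡ n z _) ⟩
  z * ∑ n (weight f I J k) * 4 ^ k          ≡⟨ *-assoc z _ _ ⟩
  z * (∑ n (weight f I J k) * 4 ^ k)        ≡⟨ cong (z *_) (trans (*-comm _ (4 ^ k)) (∑-weight f k d)) ⟩
  z * (total f ^ k * 2 ^ n)                 ∎
  where open ≤-Reasoning

weight≡1 : ∀ f {I J} k (v : Vec Bool n) → (∀ {j} → j < k → f (at v (I j)) (at v (J j)) ≡ 1) → weight f I J k v ≡ 1
weight≡1 f zero    v eq = refl
weight≡1 f (suc k) v eq = cong₂ _*_ (eq ≤-refl) (weight≡1 f k v (eq ∘ m<n⇒m<1+n))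

-- Exponential weights and tail bounds.

cost : (Bool → Bool → ℕ) → (I J : ℕ → ℕ) → ℕ → Vec Bool n → ℕ
cost c I J zero    v = 0
cost c I J (suc k) v = c (at v (I k)) (at v (J k)) + cost c I J k v

-- The hypothesis says that `f` is z (x/y)^c, cleared of denominators, so `weight` is an exponential
-- moment of `cost`.
module Tilt (c f : Bool → Bool → ℕ) {x y z : ℕ} (tilt : ∀ a b → f a b * y ^ c a b ≡ x ^ c a b * z) where

  weight-cost : ∀ {I J} k (v : Vec Bool n) → weight f I J k v * y ^ cost c I J k v ≡ x ^ cost c I J k v * z ^ k
  weight-cost zero    v = refl
  weight-cost {I = I} {J} (suc k) v = begin
    f a b * W * y ^ (c a b + s)            ≡⟨ cong (f a b * W *_) (^-distribˡ-+-* y (c a b) s) ⟩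
    f a b * W * (y ^ c a b * y ^ s)        ≡⟨ interchange (f a b) W _ _ ⟩
    (f a b * y ^ c a b) * (W * y ^ s)      ≡⟨ cong₂ _*_ (tilt a b) (weight-cost k v) ⟩
    (x ^ c a b * z) * (x ^ s * z ^ k)      ≡⟨ interchange (x ^ c a b) z _ _ ⟩
    (x ^ c a b * x ^ s) * (z * z ^ k)      ≡⟨ cong (_* (z * z ^ k)) (^-distribˡ-+-* x (c a b) s) ⟨
    x ^ (c a b + s) * (z * z ^ k)          ∎
    where
    open ≡-Reasoning
    a = at v (I k)
    b = at v (J k)
    W = weight f I J k v
    s = cost c I J k v
    interchange : ∀ a b c d → a * b * (c * d) ≡ (a * c) * (b * d)
    interchange = solve-∀

  -- Lower tail: for x/y at most 1, a cost of at most t gives (x/y)^cost at least (x/y)^t.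
  cost≤⇒weight : x ≤ y → ∀ {I J t} k (v : Vec Bool n) → cost c I J k v ≤ t → x ^ t * z ^ k ≤ y ^ t * weight f I J k v
  cost≤⇒weight x≤y {I} {J} {t} k v s≤t = begin
    x ^ t * z ^ k                  ≡⟨ cong (λ e → x ^ e * z ^ k) (m∸n+n≡m s≤t) ⟨
    x ^ (t ∸ s + s) * z ^ k        ≡⟨ cong (_* z ^ k) (^-distribˡ-+-* x (t ∸ s) s) ⟩
    x ^ (t ∸ s) * x ^ s * z ^ k    ≡⟨ *-assoc (x ^ (t ∸ s)) _ _ ⟩
    x ^ (t ∸ s) * (x ^ s * z ^ k)  ≤⟨ *-monoˡ-≤ _ (^-monoˡ-≤ (t ∸ s) x≤y) ⟩
    y ^ (t ∸ s) * (x ^ s * z ^ k)  ≡⟨ cong (y ^ (t ∸ s) *_) (weight-cost k v) ⟨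
    y ^ (t ∸ s) * (W * y ^ s)      ≡⟨ rotate (y ^ (t ∸ s)) W _ ⟩
    y ^ (t ∸ s) * y ^ s * W        ≡⟨ cong (_* W) (^-distribˡ-+-* y (t ∸ s) s) ⟨
    y ^ (t ∸ s + s) * W            ≡⟨ cong (λ e → y ^ e * W) (m∸n+n≡m s≤t) ⟩
    y ^ t * W                      ∎
    where
    open ≤-Reasoning
    W = weight f I J k v
    s = cost c I J k v
    rotate : ∀ a b c → a * (b * c) ≡ a * c * b
    rotate = solve-∀

  -- Upper tail: for x/y at least 1 the power grows with the cost. The surplus power of `y` is
  -- cancelled, which requires `y` to be nonzero.
  cost≥⇒weight : y ≤ x → .{{NonZero y}} → ∀ {I J t} k (v : Vec Bool n) → t ≤ cost c I J k v → x ^ t * z ^ k ≤ y ^ t * weight f I J k v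
  cost≥⇒weight y≤x {I} {J} {t} k v t≤s = *-cancelʳ-≤ _ _ (y ^ (s ∸ t)) {{m^n≢0 y (s ∸ t)}} (begin
    x ^ t * z ^ k * y ^ (s ∸ t)    ≤⟨ *-monoʳ-≤ (x ^ t * z ^ k) (^-monoˡ-≤ (s ∸ t) y≤x) ⟩
    x ^ t * z ^ k * x ^ (s ∸ t)    ≡⟨ rotate (x ^ t) _ _ ⟩
    x ^ t * x ^ (s ∸ t) * z ^ k    ≡⟨ cong (_* z ^ k) (^-distribˡ-+-* x t (s ∸ t)) ⟨
    x ^ (t + (s ∸ t)) * z ^ k      ≡⟨ cong (λ e → x ^ e * z ^ k) (m+[n∸m]≡n t≤s) ⟩
    x ^ s * z ^ k                  ≡⟨ weight-cost k v ⟨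
    W * y ^ s                      ≡⟨ cong (λ e → W * y ^ e) (m+[n∸m]≡n t≤s) ⟨
    W * y ^ (t + (s ∸ t))          ≡⟨ cong (W *_) (^-distribˡ-+-* y t (s ∸ t)) ⟩
    W * (y ^ t * y ^ (s ∸ t))      ≡⟨ assoc W (y ^ t) _ ⟩
    y ^ t * W * y ^ (s ∸ t)        ∎)
    where
    open ≤-Reasoning
    W = weight f I J k v
    s = cost c I J k v
    rotate : ∀ a b c → a * b * c ≡ a * c * b
    rotate = solve-∀
    assoc : ∀ a b c → a * (b * c) ≡ b * a * c
    assoc = solve-∀

-- Disjoint pairs with a prescribed difference.

-- Starting at c, blocks of length suc e consist alternately of left and of right members of pairs
-- with difference suc e; the parameter e is the difference minus one, which keeps the divisor nonzero.
left right : (c e j : ℕ) → ℕ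
left  c e j = c + (j + j / suc e * suc e)
right c e j = left c e j + suc e

left-mono-< : ∀ c e {i j} → i < j → left c e i < left c e j
left-mono-< c e i<j = +-monoʳ-< c (+-mono-<-≤ i<j (*-monoˡ-≤ (suc e) (/-monoˡ-≤ (suc e) (<⇒≤ i<j))))

left-injective : ∀ c e {i j} → left c e i ≡ left c e j → i ≡ j
left-injective c e {i} {j} eq with <-cmp i j
... | tri< i<j _ _ = contradiction eq (<⇒≢ (left-mono-< c e i<j))
... | tri≈ _ i≡j _ = i≡j
... | tri> _ _ j<i = contradiction (sym eq) (<⇒≢ (left-mono-< c e j<i))

-- After subtraction of `c`, the quotient by `suc e` is even for left members and odd for right
-- members.
left≢right : ∀ c e {i j} → left c e i ≢ right c e j
left≢right c e {i} {j} eq = even≢odd (i / d) (j / d) (begin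
  2 * (i / d)                  ≡⟨ quotient i ⟨
  (i + i / d * d) / d          ≡⟨ cong (_/ d) (+-cancelˡ-≡ c _ _ (trans eq (reassoc c j (j / d) d))) ⟩
  (j + suc (j / d) * d) / d    ≡⟨ trans (+-distrib-/-∣ʳ j (n∣m*n (suc (j / d)))) (cong (j / d +_) (m*n/n≡m (suc (j / d)) d)) ⟩
  j / d + suc (j / d)          ≡⟨ odd (j / d) ⟩
  suc (2 * (j / d))            ∎)
  where
  open ≡-Reasoning
  d = suc e
  quotient : ∀ i → (i + i / d * d) / d ≡ 2 * (i / d)
  quotient i = trans (+-distrib-/-∣ʳ i (n∣m*n (i / d)))
                 (trans (cong (i / d +_) (m*n/n≡m (i / d) d)) (cong (i / d +_) (sym (+-identityʳ _))))
  reassoc : ∀ c j q d → c + (j + q * d) + d ≡ c + (j + (d + q * d))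
  reassoc = solve-∀
  odd : ∀ q → q + suc q ≡ suc (2 * q)
  odd = solve-∀

-- Rounding j down to a multiple of `suc e` gives at most j, so the pairs stay within 2k + (e + 1)
-- places from `c` on.
left-right-disjoint : ∀ c e {n k} → c + (k + k) + suc e ≤ n → Disjoint n k (left c e) (right c e)
left-right-disjoint c e {n} {k} le = record
  { I<    = λ j<k → ≤-<-trans (m≤m+n _ (suc e)) (right< j<k)
  ; J<    = right<
  ; I-inj = λ {i} {j} _ _ → left-injective c e {i} {j}
  ; J-inj = λ {i} {j} _ _ eq → left-injective c e {i} {j} (+-cancelʳ-≡ (suc e) _ _ eq)
  ; I≢J   = λ {i} {j} _ _ → left≢right c e {i} {j} }
  where
  right< : ∀ {j} → j < k → right c e j < n
  right< {j} j<k = <-≤-trans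
    (+-monoˡ-< (suc e) (+-monoʳ-< c (+-mono-<-≤ j<k (≤-trans (m/n*n≤m j (suc e)) (<⇒≤ j<k))))) le

-- Codes of summands, and sums avoiding a point.

Code : ∀ s r → Vec Bool (s + r) → Vec Bool l → Set
Code s r D A = ∃[ B ] ∃[ C ] (D ≡ B ++ C × Sumset {m = s} {n = r} A B C)

Code-functional : ∀ s r {D} {A A′ : Vec Bool l} → Code s r D A → Code s r D A′ → A ≡ A′
Code-functional s r (B , C , eq , S) (B′ , C′ , eq′ , S′) with ++-injective B B′ (trans (sym eq) eq′)
... | refl , refl = Sumset-functional S S′

-- The k coordinates going up from `i` lie in the first summand, and the k going down from `e` in
-- the second.
Fits : (s r k i e : ℕ) → Set
Fits s r k i e = i + k ≤ s × s + k ≤ suc e × e < s + r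

-- With e = s + c, the pair consists of i + j in the first summand and c - j in the second, so every
-- pair has the sum i + c.
NotBoth : (k i e : ℕ) → Vec Bool n → Set
NotBoth k i e D = ∀ {j} → j < k → ¬ (i + j ∈ᵛ D × e ∸ j ∈ᵛ D)

-- Each of the k disjoint pairs is left with three of its four bit patterns.
Count-NotBoth : ∀ s r k i e → Fits s r k i e → Count {s + r} (NotBoth k i e) (1 * 4 ^ k) (1 * (3 ^ k * 2 ^ (s + r)))
Count-NotBoth s r k i e (i+k≤s , s+k≤1+e , e<s+r) =
  Count-⊆ (λ {D} ∌ → ≤-reflexive (sym (cong (1 *_) (weight≡1 f k D λ j<k → f≡1 (λ p q → ∌ j<k (p , q))))))
          (Count-weight-pairs f disjoint 1)
  where
  f : Bool → Bool → ℕ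
  f a b = if a ∧ b then 0 else 1
  f≡1 : ∀ {a b} → (a ≡ true → b ≡ true → ⊥) → f a b ≡ 1
  f≡1 {false} {_}     _ = refl
  f≡1 {true}  {false} _ = refl
  f≡1 {true}  {true}  ∌ = contradiction refl (∌ refl)
  left< : ∀ {j} → j < k → i + j < s
  left< j<k = <-≤-trans (+-monoʳ-< i j<k) i+k≤s
  s+j≤e : ∀ {j} → j < k → s + j ≤ e
  s+j≤e {j} j<k = ≤-pred (≤-trans (+-monoʳ-< s j<k) s+k≤1+e)
  j≤e : ∀ {j} → j < k → j ≤ e
  j≤e {j} j<k = m+n≤o⇒n≤o s (s+j≤e j<k)
  disjoint : Disjoint (s + r) k (i +_) (e ∸_)
  disjoint = record
    { I<    = λ j<k → <-≤-trans (left< j<k) (m≤m+n s r)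
    ; J<    = λ {j} _ → ≤-<-trans (m∸n≤m e j) e<s+r
    ; I-inj = λ _ _ → +-cancelˡ-≡ i _ _
    ; J-inj = λ j<k j′<k → ∸-cancelˡ-≡ (j≤e j<k) (j≤e j′<k)
    ; I≢J   = λ {_} {j′} j<k j′<k → <⇒≢ (<-≤-trans (left< j<k) (m+n≤o⇒m≤o∸n s (s+j≤e j′<k))) }

-- Costs and weights for a short summand.

⟦_⟧ : Bool → ℕ
⟦ b ⟧ = if b then 1 else 0

-- The weights are 25 (6/5)^costA and 16 (3/4)^costB; their totals 121 and 46 lie close enough to
-- 4 · 25 and 4 · 16 for a threshold of 1.1 per pair to be exponentially unlikely on both sides.
costA costB weightA weightB : Bool → Bool → ℕ
costA a b = ⟦ a ⟧ + ⟦ b ⟧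
costB a b = ⟦ a ⟧ + ⟦ a ∨ b ⟧

weightA false false = 25
weightA true  true  = 36
weightA _     _     = 30

weightB false false = 16
weightB false true  = 12
weightB true  _     = 9

tiltA : ∀ a b → weightA a b * 5 ^ costA a b ≡ 6 ^ costA a b * 25
tiltA false false = refl
tiltA false true  = refl
tiltA true  false = refl
tiltA true  true  = refl

tiltB : ∀ a b → weightB a b * 4 ^ costB a b ≡ 3 ^ costB a b * 16
tiltB false false = refl
tiltB false true  = refl
tiltB true  false = refl
tiltB true  true  = refl

cost-mono : ∀ {c c′ I J I′ J′} k (u : Vec Bool m) (v : Vec Bool n) →
            (∀ {j} → j < k → c (at u (I j)) (at u (J j)) ≤ c′ (at v (I′ j)) (at v (J′ j))) →
            cost c I J k u ≤ cost c′ I′ J′ k v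
cost-mono zero    u v le = z≤n
cost-mono (suc k) u v le = +-mono-≤ (le ≤-refl) (cost-mono k u v (le ∘ m<n⇒m<1+n))

-- Here a, b are the bits of B at i, i + d and a′, b′ those of A at c + i, c + i + d. As c and c + d
-- lie in C, i ∈ B forces a′ and b′, and i + d ∈ B forces b′.
costB≤costA : ∀ {a b a′ b′} → (a ≡ true → a′ ≡ true) → (a ≡ true → b′ ≡ true) → (b ≡ true → b′ ≡ true) →
              costB a b ≤ costA a′ b′
costB≤costA {false} {false} _ _ _ = z≤n
costB≤costA {false} {true} {a′} f g h rewrite h refl = m≤n+m 1 ⟦ a′ ⟧
costB≤costA {true}  {_}     f g h rewrite f refl | g refl = ≤-refl

-- The four events covering decomposable sets.

-- `P` is the number of pairs and `t` the threshold. The hypotheses leave room for k pairs inside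
-- [k, N - k], and for P pairs with shift below k and difference at most k.
module Events (N k P t : ℕ) (4k≤N : 4 * k ≤ N) (2P+2k≤N : k + (P + P) + k ≤ N) where

  -- `Full` and `Dense` restrict A itself, `Missing` and `Sparse` a code of A. In `Missing`, `m`
  -- bounds the first summand; in `Sparse`, the second summand has only k bits.
  Full Missing Dense Sparse : Vec Bool (suc N) → Set
  Full A    = ∀ {x} → k ≤ x → x + k ≤ N → x ∈ᵛ A
  Missing A = ∃[ m ] (m < suc N × ∃[ D ] (Code (suc m) (suc (N ∸ m)) D A ×
                ∃[ i ] (i < 2 + N × ∃[ e ] (e < 2 + N × Fits (suc m) (suc (N ∸ m)) k i e × NotBoth k i e D))))
  Dense A   = ∃[ c ] (c < k × ∃[ e ] (e < k × t ≤ cost costA (left c e) (right c e) P A))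
  Sparse A  = ∃[ D ] (Code (suc N) k D A × ∃[ e ] (e < k × cost costB (left 0 e) (right 0 e) P D ≤ t))

  -- The 2k coordinates k + j and 2k + j with j < k lie in [k, N - k], so all of these bits are
  -- forced.
  Count-Full : Count Full (1 * 4 ^ k) (1 * (1 ^ k * 2 ^ suc N))
  Count-Full = Count-⊆ (λ {A} full → ≤-reflexive (sym (cong (1 *_) (weight≡1 f k A λ {j} j<k →
      cong₂ f (full (m≤m+n k j) (≤-trans (bound₁ j<k) 4k≤N))
              (full (≤-trans (m≤m+n k k) (m≤m+n (k + k) j)) (≤-trans (bound₂ j<k) 4k≤N))))))
    (Count-weight-pairs f record
      { I<    = λ j<k → s≤s (≤-trans (≤-trans (m≤m+n _ k) (bound₁ j<k)) 4k≤N)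
      ; J<    = λ j<k → s≤s (≤-trans (≤-trans (m≤m+n _ k) (bound₂ j<k)) 4k≤N)
      ; I-inj = λ _ _ → +-cancelˡ-≡ k _ _
      ; J-inj = λ _ _ → +-cancelˡ-≡ (k + k) _ _
      ; I≢J   = λ j<k _ → <⇒≢ (<-≤-trans (+-monoʳ-< k j<k) (m≤m+n (k + k) _)) } 1)
    where
    f : Bool → Bool → ℕ
    f a b = if a ∧ b then 1 else 0
    4k : k + k + k + k ≡ 4 * k
    4k = lemma k
      where
      lemma : ∀ k → k + k + k + k ≡ 4 * k
      lemma = solve-∀
    bound₂ : ∀ {j} → j < k → k + k + j + k ≤ 4 * k
    bound₂ {j} j<k = begin
      k + k + j + k  ≤⟨ +-monoˡ-≤ k (+-monoʳ-≤ (k + k) (<⇒≤ j<k)) ⟩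
      k + k + k + k  ≡⟨ 4k ⟩
      4 * k          ∎
      where open ≤-Reasoning
    bound₁ : ∀ {j} → j < k → k + j + k ≤ 4 * k
    bound₁ {j} j<k = ≤-trans (+-monoˡ-≤ k (+-monoˡ-≤ j (m≤m+n k k))) (bound₂ j<k)

  Count-Missing : Count Missing (1 * 4 ^ k) (suc N * ((2 + N) * ((2 + N) * (1 * (3 ^ k * 2 ^ (2 + N))))))
  Count-Missing = Count-∃< (suc N) λ m m<1+N → Count-encode (Code-functional (suc m) (suc (N ∸ m)))
    (Count-∃< (2 + N) λ i _ → Count-∃< (2 + N) λ e _ → Count-assume λ fits →
      -- A code has 2 + N bits whatever `m` is, so the bound is uniform in `m`.
      subst (λ l → Count {suc m + suc (N ∸ m)} (NotBoth k i e) (1 * 4 ^ k) (1 * (3 ^ k * 2 ^ l)))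
        (trans (cong suc (+-suc m _)) (cong (2 +_) (m+[n∸m]≡n (≤-pred m<1+N))))
        (Count-NotBoth (suc m) (suc (N ∸ m)) k i e fits))

  Count-Dense : Count Dense (6 ^ t * 25 ^ P * 4 ^ P) (k * (k * (5 ^ t * (121 ^ P * 2 ^ suc N))))
  Count-Dense = Count-∃< k λ c c<k → Count-∃< k λ e e<k →
    Count-⊆ (λ {A} → Tilt.cost≥⇒weight costA weightA tiltA (n≤1+n 5) P A)
      (Count-weight-pairs {k = P} weightA (left-right-disjoint c e
        (≤-trans (+-mono-≤ (+-monoˡ-≤ (P + P) (<⇒≤ c<k)) e<k) (m≤n⇒m≤1+n 2P+2k≤N))) (5 ^ t))

  sparse-disjoint : ∀ {n e} → N ≤ n → e < k → Disjoint n P (left 0 e) (right 0 e)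
  sparse-disjoint {n} {e} N≤n e<k = left-right-disjoint 0 e
    (≤-trans (+-mono-≤ (m≤n+m (P + P) k) e<k) (≤-trans 2P+2k≤N N≤n))

  -- The k bits of the short summand are part of the code and account for the extra factor 2^k.
  Count-Sparse : Count Sparse (3 ^ t * 16 ^ P * 4 ^ P) (k * (4 ^ t * (46 ^ P * 2 ^ (suc N + k))))
  Count-Sparse = Count-encode (Code-functional (suc N) k) (Count-∃< k λ e e<k →
    Count-⊆ (λ {D} → Tilt.cost≤⇒weight costB weightB tiltB (n≤1+n 3) P D)
      (Count-weight-pairs {k = P} weightB (sparse-disjoint (≤-trans (n≤1+n N) (m≤m+n (suc N) k)) e<k) (4 ^ t)))

  -- If the cost of A is at most `t`, so is that of B, because A contains the translates of B by c
  -- and c′.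
  dense-or-sparse : ∀ {A B C : Vec Bool (suc N)} {c c′} → Sumset A B C → (∀ {c} → c ∈ᵛ C → c < k) →
                    c < c′ → c ∈ᵛ C → c′ ∈ᵛ C → Dense A ⊎ Sparse A
  dense-or-sparse {A} {B} {C} {c} {c′} S C<k c<c′ c∈C c′∈C
    -- The argument `c′ ∸ suc c` is the difference minus one.
    with ≤-total t (cost costA (left c (c′ ∸ suc c)) (right c (c′ ∸ suc c)) P A)
  ... | inj₁ t≤cost = inj₁ (c , C<k c∈C , c′ ∸ suc c , ≤-<-trans (m∸n≤m c′ (suc c)) (C<k c′∈C) , t≤cost)
  ... | inj₂ cost≤t = inj₂ (B′ ++ C′ , (B′ , C′ , refl , Sumset-restrict (suc N) k (∈ᵛ⇒< B) C<k S) ,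
                            e , e<k , ≤-trans (cost-mono P (B′ ++ C′) A pointwise) cost≤t)
    where
    e  = c′ ∸ suc c
    B′ = restrict (suc N) (at B)
    C′ = restrict k (at C)
    e<k : e < k
    e<k = ≤-<-trans (m∸n≤m c′ (suc c)) (C<k c′∈C)
    c+1+e : c + suc e ≡ c′
    c+1+e = trans (+-suc c e) (m+[n∸m]≡n c<c′)
    -- Taken at length `suc N`, the bounds place all pairs in the first part of the code, which is
    -- B.
    open Disjoint (sparse-disjoint {suc N} (n≤1+n N) e<k)
    back : ∀ {i} → i < suc N → i ∈ᵛ B′ ++ C′ → i ∈ᵛ B
    back {i} i<1+N i∈ = trans (sym (trans (at-++ˡ B′ C′ i<1+N) (at-restrict {f = at B} i<1+N))) i∈
    pointwise : ∀ {j} → j < P → costB (at (B′ ++ C′) (left 0 e j)) (at (B′ ++ C′) (right 0 e j))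
                              ≤ costA (at A (left c e j)) (at A (right c e j))
    pointwise {j} j<P = costB≤costA
      (λ i∈ → subst (_∈ᵛ A) (+-comm i c) (S .+-∈ (back (I< j<P) i∈) c∈C))
      (λ i∈ → subst (_∈ᵛ A) (trans (cong (i +_) (sym c+1+e)) (lemma i c (suc e))) (S .+-∈ (back (I< j<P) i∈) c′∈C))
      (λ i∈ → subst (_∈ᵛ A) (lemma′ i c (suc e)) (S .+-∈ (back (J< j<P) i∈) c∈C))
      where
      i = left 0 e j
      lemma : ∀ i c d → i + (c + d) ≡ c + i + d
      lemma = solve-∀
      lemma′ : ∀ i c d → i + d + c ≡ c + i + d
      lemma′ = solve-∀

  -- A missed x is written as i + c with k steps of room up from i and down from c. Both bits of a
  -- pair being set would give x = (i + j) + (c - j) ∈ A.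
  full-or-missing : ∀ {A B C : Vec Bool (suc N)} {m} → Sumset A B C → m ≤ N → (∀ {b} → b ∈ᵛ B → b ≤ m) →
                    (∀ {c} → c ∈ᵛ C → c ≤ N ∸ m) → k ≤ m → k ≤ N ∸ m → Full A ⊎ Missing A
  full-or-missing {A} {B} {C} {m} S m≤N B≤m C≤r k≤m k≤r
    with anyUpTo? (λ x → (k ≤? x) ×-dec (x + k ≤? N) ×-dec (at A x Bool.≟ false)) (suc N)
  ... | no  ∄ = inj₁ λ {x} k≤x x+k≤N → Bool.¬-not λ x∉A → ∄ (x , s≤s (m+n≤o⇒m≤o x x+k≤N) , k≤x , x+k≤N , x∉A)
  ... | yes (x , _ , k≤x , x+k≤N , x∉A) = inj₂ (missing (split (≤-total x r)))
    where
    r  = N ∸ m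
    m+r≡N : m + r ≡ N
    m+r≡N = m+[n∸m]≡n m≤N
    B′ = restrict (suc m) (at B)
    C′ = restrict (suc r) (at C)
    S′ : Sumset A B′ C′
    S′ = Sumset-restrict (suc m) (suc r) (s≤s ∘ B≤m) (s≤s ∘ C≤r) S
    -- If x ≤ r, take i = 0 and c = x. Otherwise take c = r and i = x - r; then i + k ≤ m follows
    -- from x + k ≤ N = m + r.
    split : x ≤ r ⊎ r ≤ x → ∃[ i ] ∃[ c ] (i + c ≡ x × i + k ≤ m × k ≤ c × c ≤ r)
    split (inj₁ x≤r) = 0 , x , refl , k≤m , k≤x , x≤r
    split (inj₂ r≤x) = x ∸ r , r , m∸n+n≡m r≤x , +-cancelʳ-≤ r _ _ bound , k≤r , ≤-refl
      where
      bound : x ∸ r + k + r ≤ m + r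
      bound = begin
        x ∸ r + k + r    ≡⟨ +-assoc (x ∸ r) k r ⟩
        x ∸ r + (k + r)  ≡⟨ cong (x ∸ r +_) (+-comm k r) ⟩
        x ∸ r + (r + k)  ≡⟨ +-assoc (x ∸ r) r k ⟨
        x ∸ r + r + k    ≡⟨ cong (_+ k) (m∸n+n≡m r≤x) ⟩
        x + k            ≤⟨ x+k≤N ⟩
        N                ≡⟨ m+r≡N ⟨
        m + r            ∎
        where open ≤-Reasoning
    missing : ∃[ i ] ∃[ c ] (i + c ≡ x × i + k ≤ m × k ≤ c × c ≤ r) → Missing A
    missing (i , c , i+c≡x , i+k≤m , k≤c , c≤r) =
      m , s≤s m≤N , B′ ++ C′ , (B′ , C′ , refl , S′) ,
      i , s≤s (≤-trans (m+n≤o⇒m≤o i i+k≤m) (m≤n⇒m≤1+n m≤N)) ,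
      -- The second part of the code starts at coordinate `suc m`.
      suc m + c , s≤s (s≤s (≤-trans (+-monoʳ-≤ m c≤r) (≤-reflexive m+r≡N))) ,
      (m≤n⇒m≤1+n i+k≤m , m≤n⇒m≤1+n (+-monoʳ-≤ (suc m) k≤c) , +-monoʳ-< (suc m) (s≤s c≤r)) ,
      λ {j} j<k (p , q) → case trans (sym x∉A) (sum-in j<k p q) of λ ()
      where
      sum-in : ∀ {j} → j < k → i + j ∈ᵛ B′ ++ C′ → suc m + c ∸ j ∈ᵛ B′ ++ C′ → x ∈ᵛ A
      sum-in {j} j<k p q = subst (_∈ᵛ A)
        (trans (+-assoc i j _) (trans (cong (i +_) (m+[n∸m]≡n j≤c)) i+c≡x))
        (S′ .+-∈ {i + j} {c ∸ j} (trans (sym (at-++ˡ B′ C′ (s≤s (≤-trans (+-monoʳ-≤ i (<⇒≤ j<k)) i+k≤m)))) p)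
                 (trans (sym (at-++ʳ B′ C′)) (subst (_∈ᵛ B′ ++ C′) (+-∸-assoc (suc m) j≤c) q)))
        where
        j≤c : j ≤ c
        j≤c = ≤-trans (<⇒≤ j<k) k≤c

  -- With m = max B, a summand is short if m or N - m is below k; the two elements it must contain
  -- supply c and c′. Otherwise both parts of the code have room for k pairs.
  dichotomy : ∀ {A} → InDec N A → (Full A ⊎ Missing A) ⊎ (Dense A ⊎ Sparse A)
  dichotomy {A} (B , C , isSumset , 2≤∣B∣ , 2≤∣C∣) with maximum B | 2≤∣∣⇒∃₂ B 2≤∣B∣ | 2≤∣∣⇒∃₂ C 2≤∣C∣
  ... | inj₁ ∉B              | b , _ , _ , b∈B , _        | _ = contradiction b∈B (∉B b)
  ... | inj₂ (m , m∈B , max) | b , b′ , b<b′ , b∈B , b′∈B | c , c′ , c<c′ , c∈C , c′∈C = cases (m <? k) (N ∸ m <? k)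
    where
    S = IsSumset⇒Sumset isSumset
    C≤ : ∀ {c} → c ∈ᵛ C → c ≤ N ∸ m
    -- m + c belongs to A, which lies in [0, N].
    C≤ {c} c∈C = m+n≤o⇒m≤o∸n c (≤-trans (≤-reflexive (+-comm c m)) (≤-pred (∈ᵛ⇒< A (S .+-∈ m∈B c∈C))))
    cases : Dec (m < k) → Dec (N ∸ m < k) → (Full A ⊎ Missing A) ⊎ (Dense A ⊎ Sparse A)
    cases (yes m<k) _         = inj₂ (dense-or-sparse (Sumset-comm S) (λ b∈B → ≤-<-trans (max _ b∈B) m<k) b<b′ b∈B b′∈B)
    cases (no  _)   (yes r<k) = inj₂ (dense-or-sparse S (λ c∈C → ≤-<-trans (C≤ c∈C) r<k) c<c′ c∈C c′∈C)
    cases (no  m≮k) (no  r≮k) = inj₁ (full-or-missing S (≤-pred (∈ᵛ⇒< B m∈B)) (max _) C≤ (≮⇒≥ m≮k) (≮⇒≥ r≮k))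

-- Absorbing polynomial factors into exponential rates.

^-distribʳ-* : ∀ a b n → (a * b) ^ n ≡ a ^ n * b ^ n
^-distribʳ-* a b zero    = refl
^-distribʳ-* a b (suc n) = trans (cong (a * b *_) (^-distribʳ-* a b n)) (lemma a b (a ^ n) (b ^ n))
  where
  lemma : ∀ a b c d → a * b * (c * d) ≡ a * c * (b * d)
  lemma = solve-∀

^-comm : ∀ a m n → (a ^ m) ^ n ≡ (a ^ n) ^ m
^-comm a m n = trans (^-*-assoc a m n) (trans (cong (a ^_) (*-comm m n)) (sym (^-*-assoc a n m)))

-- Bernoulli's inequality for (1 + 1/M)^k, weakened from 1 + k/M to (1 + k)/M and cleared of
-- denominators.
bernoulli : ∀ M .{{_ : NonZero M}} k → suc k * M ^ k ≤ M * suc M ^ k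
bernoulli M zero    = *-mono-≤ (>-nonZero⁻¹ M) (≤-refl {1})
bernoulli M (suc k) = begin
  suc (suc k) * (M * M ^ k)                  ≡⟨ expand k M (M ^ k) ⟩
  M * M ^ k + M * (suc k * M ^ k)            ≤⟨ +-mono-≤ (*-monoʳ-≤ M (^-monoˡ-≤ k (n≤1+n M))) (*-monoʳ-≤ M (bernoulli M k)) ⟩
  M * suc M ^ k + M * (M * suc M ^ k)        ≡⟨ collect M (suc M ^ k) ⟩
  M * (suc M * suc M ^ k)                    ∎
  where
  open ≤-Reasoning
  expand : ∀ k M a → (2 + k) * (M * a) ≡ M * a + M * ((1 + k) * a)
  expand = solve-∀
  collect : ∀ M a → M * a + M * (M * a) ≡ M * ((1 + M) * a)
  collect = solve-∀

-- The cube matches the three union bounds, over `m`, `i` and `e`, in `Missing`.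
bernoulli³ : ∀ M .{{_ : NonZero M}} k → suc k ^ 3 * (M ^ 3) ^ k ≤ M ^ 3 * (suc M ^ 3) ^ k
bernoulli³ M k = begin
  suc k ^ 3 * (M ^ 3) ^ k      ≡⟨ cong (suc k ^ 3 *_) (^-comm M 3 k) ⟩
  suc k ^ 3 * (M ^ k) ^ 3      ≡⟨ ^-distribʳ-* (suc k) (M ^ k) 3 ⟨
  (suc k * M ^ k) ^ 3          ≤⟨ ^-monoˡ-≤ 3 (bernoulli M k) ⟩
  (M * suc M ^ k) ^ 3          ≡⟨ ^-distribʳ-* M (suc M ^ k) 3 ⟩
  M ^ 3 * (suc M ^ k) ^ 3      ≡⟨ cong (M ^ 3 *_) (^-comm (suc M) k 3) ⟩
  M ^ 3 * (suc M ^ 3) ^ k      ∎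
  where open ≤-Reasoning

-- The cubic factor costs (1 + 1/M)^(3k), and N ≤ E + E k turns the rate (v/u)^k into (p/q)^N.
cubic-exponential-bound :
  ∀ E M u v p q .{{_ : NonZero M}} .{{_ : NonZero u}} .{{_ : NonZero p}} .{{_ : NonZero q}} →
  suc M ^ 3 * v * q ^ E ≤ M ^ 3 * u * p ^ E →
  ∀ {N k} → E * k ≤ N → N ≤ E + E * k →
  ∀ {x c T} → x * u ^ k ≤ c * (suc k ^ 3 * (v ^ k * T)) →
  x * q ^ N ≤ c * M ^ 3 * q ^ E * (T * p ^ N)
cubic-exponential-bound E M u v p q rate {N} {k} Ek≤N N≤E+Ek {x} {c} {T} x≤ =
  -- The cancelled factor collects the denominators u^k of the hypothesis and (M^3)^k of the
  -- Bernoulli bound.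
  *-cancelʳ-≤ _ _ (u ^ k * (M ^ 3) ^ k) {{m*n≢0 (u ^ k) ((M ^ 3) ^ k) {{m^n≢0 u k}} {{m^n≢0 (M ^ 3) k {{m^n≢0 M 3}}}}}} (begin
    x * q ^ N * (u ^ k * μ)
      ≤⟨ *-monoˡ-≤ (u ^ k * μ) (*-monoʳ-≤ x q^N≤) ⟩
    x * (q ^ E * Q) * (u ^ k * μ)
      ≡⟨ regroup₁ x (q ^ E) Q (u ^ k) μ ⟩
    x * u ^ k * (μ * q ^ E * Q)
      ≤⟨ *-monoˡ-≤ (μ * q ^ E * Q) x≤ ⟩
    c * (suc k ^ 3 * (v ^ k * T)) * (μ * q ^ E * Q)
      ≡⟨ regroup₂ c (suc k ^ 3) (v ^ k) T μ (q ^ E) Q ⟩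
    suc k ^ 3 * μ * (c * q ^ E * T * (v ^ k * Q))
      ≤⟨ *-monoˡ-≤ (c * q ^ E * T * (v ^ k * Q)) (bernoulli³ M k) ⟩
    M ^ 3 * (suc M ^ 3) ^ k * (c * q ^ E * T * (v ^ k * Q))
      ≡⟨ regroup₃ (M ^ 3) ((suc M ^ 3) ^ k) c (q ^ E) T (v ^ k) Q ⟩
    K * T * ((suc M ^ 3) ^ k * v ^ k * Q)
      ≡⟨ cong (K * T *_) (^-distrib₃ (suc M ^ 3) v (q ^ E)) ⟨
    K * T * (suc M ^ 3 * v * q ^ E) ^ k
      ≤⟨ *-monoʳ-≤ (K * T) (^-monoˡ-≤ k rate) ⟩
    K * T * (M ^ 3 * u * p ^ E) ^ k
      ≡⟨ cong (K * T *_) (^-distrib₃ (M ^ 3) u (p ^ E)) ⟩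
    K * T * (μ * u ^ k * (p ^ E) ^ k)
      ≤⟨ *-monoʳ-≤ (K * T) (*-monoʳ-≤ (μ * u ^ k) p^Ek≤) ⟩
    K * T * (μ * u ^ k * p ^ N)
      ≡⟨ regroup₄ K T μ (u ^ k) (p ^ N) ⟩
    K * (T * p ^ N) * (u ^ k * μ) ∎)
  where
  open ≤-Reasoning
  μ = (M ^ 3) ^ k
  Q = (q ^ E) ^ k
  K = c * M ^ 3 * q ^ E
  q^N≤ : q ^ N ≤ q ^ E * Q
  q^N≤ = begin
    q ^ N                ≤⟨ ^-monoʳ-≤ q N≤E+Ek ⟩
    q ^ (E + E * k)      ≡⟨ ^-distribˡ-+-* q E (E * k) ⟩
    q ^ E * q ^ (E * k)  ≡⟨ cong (q ^ E *_) (^-*-assoc q E k) ⟨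
    q ^ E * Q            ∎
  p^Ek≤ : (p ^ E) ^ k ≤ p ^ N
  p^Ek≤ = ≤-trans (≤-reflexive (^-*-assoc p E k)) (^-monoʳ-≤ p Ek≤N)
  ^-distrib₃ : ∀ a b c → (a * b * c) ^ k ≡ a ^ k * b ^ k * c ^ k
  ^-distrib₃ a b c = trans (^-distribʳ-* (a * b) c k) (cong (_* c ^ k) (^-distribʳ-* a b k))
  regroup₁ : ∀ x e Q u μ → x * (e * Q) * (u * μ) ≡ x * u * (μ * e * Q)
  regroup₁ = solve-∀
  regroup₂ : ∀ c s v T μ e Q → c * (s * (v * T)) * (μ * e * Q) ≡ s * μ * (c * e * T * (v * Q))
  regroup₂ = solve-∀
  regroup₃ : ∀ M s c e T v Q → M * s * (c * e * T * (v * Q)) ≡ c * M * e * T * (s * v * Q)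
  regroup₃ = solve-∀
  regroup₄ : ∀ K T μ u p → K * T * (μ * u * p) ≡ K * (T * p) * (u * μ)
  regroup₄ = solve-∀

^-scale₂ : ∀ a b α β k → a ^ (α * k) * b ^ (β * k) ≡ (a ^ α * b ^ β) ^ k
^-scale₂ a b α β k = trans (cong₂ _*_ (sym (^-*-assoc a α k)) (sym (^-*-assoc b β k))) (sym (^-distribʳ-* (a ^ α) (b ^ β) k))

^-scale₃ : ∀ a b c α β γ k → a ^ (α * k) * b ^ (β * k) * c ^ (γ * k) ≡ (a ^ α * b ^ β * c ^ γ) ^ k
^-scale₃ a b c α β γ k = trans (cong₂ _*_ (^-scale₂ a b α β k) (sym (^-*-assoc c γ k))) (sym (^-distribʳ-* (a ^ α * b ^ β) (c ^ γ) k))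

-- Numerical constants and the final count.

-- Numerically, the four rates v/u are 1/4, 3/4, (121/100)⁶⁰ (5/6)⁶⁶ ≈ 0.55 and 2 (46/64)⁶⁰ (4/3)⁶⁶ ≈ 0.88.
rate-base : ℕ → ℕ → Set
rate-base u v = 101 ^ 3 * v * 2001 ^ 122 ≤ 100 ^ 3 * u * 2000 ^ 122

-- The factor `c * M ^ 3 * q ^ E` from `cubic-exponential-bound` at M = 100, q = 2001 and E = 122.
constant : ℕ → ℕ
constant c = c * 100 ^ 3 * 2001 ^ 122

-- All four counts are brought to the common rate 2000/2001 and added; the rate inequalities are
-- checked by evaluation.
Count-InDec : ∀ N → Count (InDec N) (2001 ^ N)
  (constant 1 * (2 ^ suc N * 2000 ^ N) + constant (123 * 123 * 123 * 2) * (2 ^ suc N * 2000 ^ N)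
   + (constant 1 * (2 ^ suc N * 2000 ^ N) + constant 1 * (2 ^ suc N * 2000 ^ N)))
Count-InDec N = Count-⊆ dichotomy
  (Count-⊎ (Count-⊎ (rescale 4 1 1 (≤ᵇ⇒≤ _ _ tt) (*-identityˡ (4 ^ k)) full≤ Count-Full)
                    (rescale 4 3 (123 * 123 * 123 * 2) (≤ᵇ⇒≤ _ _ tt) (*-identityˡ (4 ^ k)) missing≤ Count-Missing))
           (Count-⊎ (rescale (6 ^ 66 * 25 ^ 60 * 4 ^ 60) (5 ^ 66 * 121 ^ 60) 1 (≤ᵇ⇒≤ _ _ tt)
                             (^-scale₃ 6 25 4 66 60 60 k) dense≤ Count-Dense)
                    (rescale (3 ^ 66 * 16 ^ 60 * 4 ^ 60) (4 ^ 66 * 46 ^ 60 * 2) 1 (≤ᵇ⇒≤ _ _ tt)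
                             (^-scale₃ 3 16 4 66 60 60 k) sparse≤ Count-Sparse)))
  where
  -- The 60 k pairs take 120 k places, and shift and difference take up to k more each. Sixty is
  -- large enough to outweigh the 2^k choices of the short summand.
  k = N / 122
  T = 2 ^ suc N
  N≡ : N ≡ N % 122 + k * 122
  N≡ = m≡m%n+[m/n]*n N 122
  122k≤N : 122 * k ≤ N
  122k≤N = ≤-trans (≤-reflexive (*-comm 122 k)) (m/n*n≤m N 122)
  N≤ : N ≤ 122 + 122 * k
  N≤ = ≤-trans (≤-reflexive N≡) (+-mono-≤ (<⇒≤ (m%n<n N 122)) (≤-reflexive (*-comm k 122)))
  4k≤N : 4 * k ≤ N
  4k≤N = ≤-trans (*-monoˡ-≤ k (≤ᵇ⇒≤ 4 122 tt)) 122k≤N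
  pairs≤N : k + (60 * k + 60 * k) + k ≤ N
  pairs≤N = ≤-trans (≤-reflexive (lemma k)) 122k≤N
    where
    lemma : ∀ k → k + (60 * k + 60 * k) + k ≡ 122 * k
    lemma = solve-∀
  -- The threshold is 1.1 per pair, between the means 1 of `costA` and 5/4 of `costB`.
  open Events N k (60 * k) (66 * k) 4k≤N pairs≤N
  rescale : ∀ u v c .{{_ : NonZero u}} {P U W} → rate-base u v → U ≡ u ^ k → W ≤ c * (suc k ^ 3 * (v ^ k * T)) →
            Count {suc N} P U W → Count P (2001 ^ N) (constant c * (T * 2000 ^ N))
  rescale u v c rate refl W≤ count L uniq pL =
    cubic-exponential-bound 122 100 u v 2000 2001 rate {N} {k} 122k≤N N≤ {length L} {c} {T} (≤-trans (count L uniq pL) W≤)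
  full≤ : 1 * (1 ^ k * T) ≤ 1 * (suc k ^ 3 * (1 ^ k * T))
  full≤ = *-monoʳ-≤ 1 (m≤n*m _ (suc k ^ 3) {{m^n≢0 (suc k) 3}})
  -- A remainder of at most 121 gives N + 2 ≤ 123 (k + 1); the further factor 2 arises because codes
  -- have 2 + N bits.
  missing≤ : suc N * ((2 + N) * ((2 + N) * (1 * (3 ^ k * 2 ^ (2 + N)))))
             ≤ 123 * 123 * 123 * 2 * (suc k ^ 3 * (3 ^ k * T))
  missing≤ = begin
    suc N * ((2 + N) * ((2 + N) * Y))  ≤⟨ *-mono-≤ (≤-trans (n≤1+n _) Z≤) (*-mono-≤ Z≤ (*-monoˡ-≤ Y Z≤)) ⟩
    z * (z * (z * Y))                  ≡⟨ lemma 123 (suc k) (3 ^ k) T ⟩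
    123 * 123 * 123 * 2 * (suc k ^ 3 * (3 ^ k * T)) ∎
    where
    open ≤-Reasoning
    Y = 1 * (3 ^ k * 2 ^ (2 + N))
    z = 123 * suc k
    Z≤ : 2 + N ≤ z
    Z≤ = begin
      2 + N                            ≡⟨ cong (2 +_) N≡ ⟩
      2 + (N % 122 + k * 122)          ≤⟨ +-mono-≤ (s≤s (m%n<n N 122)) (*-monoʳ-≤ k (n≤1+n 122)) ⟩
      123 + k * 123                    ≡⟨ *-comm (suc k) 123 ⟩
      z                                ∎
    lemma : ∀ a s t T → a * s * (a * s * (a * s * (1 * (t * (2 * T))))) ≡ a * a * a * 2 * (s * (s * (s * 1)) * (t * T))
    lemma = solve-∀
  -- Fewer than three linear factors are padded to a cube, so that one rate lemma serves all events.
  cubic≤ : ∀ a b Y → a ≤ suc k → b ≤ suc k → a * (b * Y) ≤ 1 * (suc k ^ 3 * Y)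
  cubic≤ a b Y a≤ b≤ = begin
    a * (b * Y)                        ≤⟨ *-mono-≤ a≤ (*-mono-≤ b≤ (m≤n*m Y (suc k))) ⟩
    suc k * (suc k * (suc k * Y))      ≡⟨ lemma (suc k) Y ⟩
    1 * (suc k ^ 3 * Y)                ∎
    where
    open ≤-Reasoning
    lemma : ∀ s Y → s * (s * (s * Y)) ≡ 1 * (s * (s * (s * 1)) * Y)
    lemma = solve-∀
  dense≤ : k * (k * (5 ^ (66 * k) * (121 ^ (60 * k) * T))) ≤ 1 * (suc k ^ 3 * ((5 ^ 66 * 121 ^ 60) ^ k * T))
  dense≤ = begin
    k * (k * (5 ^ (66 * k) * (121 ^ (60 * k) * T)))
      ≡⟨ cong (λ y → k * (k * y)) (*-assoc (5 ^ (66 * k)) _ T) ⟨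
    k * (k * (5 ^ (66 * k) * 121 ^ (60 * k) * T))
      ≡⟨ cong (λ y → k * (k * (y * T))) (^-scale₂ 5 121 66 60 k) ⟩
    k * (k * ((5 ^ 66 * 121 ^ 60) ^ k * T))
      ≤⟨ cubic≤ k k _ (n≤1+n k) (n≤1+n k) ⟩
    1 * (suc k ^ 3 * ((5 ^ 66 * 121 ^ 60) ^ k * T)) ∎
    where open ≤-Reasoning
  sparse≤ : k * (4 ^ (66 * k) * (46 ^ (60 * k) * 2 ^ (suc N + k))) ≤ 1 * (suc k ^ 3 * ((4 ^ 66 * 46 ^ 60 * 2) ^ k * T))
  sparse≤ = begin
    k * (4 ^ (66 * k) * (46 ^ (60 * k) * 2 ^ (suc N + k)))
      ≡⟨ cong (λ y → k * (4 ^ (66 * k) * (46 ^ (60 * k) * y))) (^-distribˡ-+-* 2 (suc N) k) ⟩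
    k * (4 ^ (66 * k) * (46 ^ (60 * k) * (T * 2 ^ k)))
      ≡⟨ lemma k (4 ^ (66 * k)) (46 ^ (60 * k)) T (2 ^ k) ⟩
    k * (1 * (4 ^ (66 * k) * 46 ^ (60 * k) * 2 ^ k * T))
      ≡⟨ cong (λ y → k * (1 * (y * 2 ^ k * T))) (^-scale₂ 4 46 66 60 k) ⟩
    k * (1 * ((4 ^ 66 * 46 ^ 60) ^ k * 2 ^ k * T))
      ≡⟨ cong (λ y → k * (1 * (y * T))) (^-distribʳ-* (4 ^ 66 * 46 ^ 60) 2 k) ⟨
    k * (1 * ((4 ^ 66 * 46 ^ 60 * 2) ^ k * T))
      ≤⟨ cubic≤ k 1 _ (n≤1+n k) (s≤s z≤n) ⟩
    1 * (suc k ^ 3 * ((4 ^ 66 * 46 ^ 60 * 2) ^ k * T)) ∎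
    where
    open ≤-Reasoning
    lemma : ∀ k a b T c → k * (a * (b * (T * c))) ≡ k * (1 * (a * b * c * T))
    lemma = solve-∀

-- The rational p/q < 1 stands for e^(-c) with c = ln(q/p), and the length of a duplicate-free list
-- for the cardinality of Dec(N).
theorem6p2 : ∃[ p ] ∃[ q ] ∃[ K ] (p < q × (∀ (N : ℕ) (L : List (Subset (suc N))) →
    Unique L → All (InDec N) L →
    length L * q ^ N ≤ K * 2 ^ (suc N) * p ^ N))
theorem6p2 = 2000 , 2001 , constant 1 + constant (123 * 123 * 123 * 2) + (constant 1 + constant 1) , n<1+n 2000 ,
  λ N L uniq inDec → ≤-trans (Count-InDec N L uniq inDec)
    (≤-reflexive (collect (constant 1) (constant (123 * 123 * 123 * 2)) (2 ^ suc N) (2000 ^ N)))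
  where
  collect : ∀ a b T p → a * (T * p) + b * (T * p) + (a * (T * p) + a * (T * p)) ≡ (a + b + (a + a)) * T * p
  collect = solve-∀
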